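{- Let $m\ge n\ge 3$, $p\le n-3$ and $q\le m-3$ be integers with $m-q\ge n-p$. Then $$\gamma_c(G(n,m)) = \begin{cases} \gamma_c(G(n-p,m-q)) + \left\lceil \dfrac q2\right\rceil, & \text{if } m \text{ is even and } q \text{ is odd},\\[8pt] \gamma_c(G(n-p,m-q)) + \left\lfloor \dfrac q2\right\rfloor, & \text{otherwise}.\end{cases}$$
   Context: For integers $n,m\ge 1$, the grid $G(n,m)$ has cell set $V_{n,m}=\{(i,j): 1\le i\le n,\ 1\le j\le m\}$ ($i$ = row, $j$ = column). Contamination rules: a cell $u=(i,j)\in V_{n,m}$ can be contaminated by two contaminated cells $v,w\in V_{n,m}$ if one of the following holds: (a) $v=(i-1,j-1)$, $w=(i+1,j+1)$; (b) $v=(i+1,j-1)$, $w=(i-1,j+1)$; (c) $v=(i-1,j)$, $w=(i+1,j)$; (d) $v=(i,j-1)$, $w=(i,j+1)$; (e) $v=(i,j-1)$, $w=(i-1,j)$; (f) $v=(i,j-1)$, $w=(i+1,j)$; (g) $v=(i+1,j)$, $w=(i,j+1)$; (h) $v=(i-1,j)$, $w=(i,j+1)$. For $S\subseteq V_{n,m}$, the final contaminated set $C(S)$ is the smallest subset of $V_{n,m}$ containing $S$ and closed under rules (a)--(h). $S$ is a contaminating set if $C(S)=V_{n,m}$. The power contamination number $\gamma_c(G(n,m))$ is the minimum cardinality of a contaminating set. -}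

module Defs where

open import Data.Fin using (Fin; toℕ; combine; remQuot)
open import Data.Fin.Properties using (_≟_; any?; all?; combine-remQuot; remQuot-combine)
open import Data.Fin.Subset using (Subset; _∈_; _∪_; ⁅_⁆; ⊤; ∣_∣)
open import Data.Fin.Subset.Properties
  using (_∈?_; anySubset?; ∈⊤; ∣⊤∣≡n; ∣p∣≤n; x∈⁅x⁆; x∈⁅y⁆⇒x≡y; x∈p∪q⁻; p⊆p∪q; q⊆p∪q; p⊂q⇒∣p∣<∣q∣)
open import Data.Nat using (ℕ; zero; suc; _+_; _*_; _≤_; z≤n; s≤s)
import Data.Nat as ℕ
import Data.Nat.Properties as ℕ
open import Data.Product using (∃; _×_; _,_; proj₁; proj₂)
open import Data.Sum using (_⊎_; inj₁; inj₂)
open import Function using (_∘_)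
open import Relation.Binary.PropositionalEquality using (_≡_; refl; sym; trans; cong; subst)
open import Relation.Nullary using (Dec; yes; no; ¬_; contradiction)
open import Relation.Nullary.Decidable using (map′; _×-dec_; _⊎-dec_; ¬?)
open import Relation.Unary using (Decidable)

-- Rows and columns are numbered from 0.
Cell : ℕ → ℕ → Set
Cell n m = Fin n × Fin m

-- i ⋖ i′ says i′ = i + 1.
infix 6 _⋖_
_⋖_ : {k : ℕ} → Fin k → Fin k → Set
i ⋖ i′ = toℕ i′ ≡ suc (toℕ i)

-- Contaminates v w u: the cells v and w, in this order, can contaminate u.
-- Row indices grow southwards, so relative to u the alternatives place v and w
-- at NW/SE, SW/NE, N/S, W/E, W/N, W/S, S/E and N/E.
Contaminates : {n m : ℕ} → Cell n m → Cell n m → Cell n m → Set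
Contaminates (vᵢ , vⱼ) (wᵢ , wⱼ) (i , j) =
    ((vᵢ ⋖ i × vⱼ ⋖ j) × (i ⋖ wᵢ × j ⋖ wⱼ))
  ⊎ ((i ⋖ vᵢ × vⱼ ⋖ j) × (wᵢ ⋖ i × j ⋖ wⱼ))
  ⊎ ((vᵢ ⋖ i × vⱼ ≡ j) × (i ⋖ wᵢ × wⱼ ≡ j))
  ⊎ ((vᵢ ≡ i × vⱼ ⋖ j) × (wᵢ ≡ i × j ⋖ wⱼ))
  ⊎ ((vᵢ ≡ i × vⱼ ⋖ j) × (wᵢ ⋖ i × wⱼ ≡ j))
  ⊎ ((vᵢ ≡ i × vⱼ ⋖ j) × (i ⋖ wᵢ × wⱼ ≡ j))
  ⊎ ((i ⋖ vᵢ × vⱼ ≡ j) × (wᵢ ≡ i × j ⋖ wⱼ))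
  ⊎ ((vᵢ ⋖ i × vⱼ ≡ j) × (wᵢ ≡ i × j ⋖ wⱼ))

-- Sets of cells are subsets of Fin (n * m), through the bijection
-- combine : Fin n → Fin m → Fin (n * m).
CellSet : ℕ → ℕ → Set
CellSet n m = Subset (n * m)

infix 4 _∈ᶜ_
_∈ᶜ_ : {n m : ℕ} → Cell n m → CellSet n m → Set
(i , j) ∈ᶜ S = combine i j ∈ S

-- The final contaminated set C(S).
data C {n m : ℕ} (S : CellSet n m) : Cell n m → Set where
  initial : {u : Cell n m} → u ∈ᶜ S → C S u
  spread  : {u v w : Cell n m} → C S v → C S w → Contaminates v w u → C S u

Contaminating : {n m : ℕ} → CellSet n m → Set
Contaminating {n} {m} S = (u : Cell n m) → C S u

HasContaminatingSetOfSize : ℕ → ℕ → ℕ → Set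
HasContaminatingSetOfSize n m k = ∃ λ (S : CellSet n m) → ∣ S ∣ ≡ k × Contaminating {n} {m} S

IsMinimum : (ℕ → Set) → ℕ → Set
IsMinimum P k = P k × (∀ l → P l → k ≤ l)

contaminates? : {n m : ℕ} (v w u : Cell n m) → Dec (Contaminates v w u)
contaminates? (vᵢ , vⱼ) (wᵢ , wⱼ) (i , j) =
          (((vᵢ ⋖? i) ×-dec (vⱼ ⋖? j)) ×-dec ((i ⋖? wᵢ) ×-dec (j ⋖? wⱼ)))
  ⊎-dec ((((i ⋖? vᵢ) ×-dec (vⱼ ⋖? j)) ×-dec ((wᵢ ⋖? i) ×-dec (j ⋖? wⱼ)))
  ⊎-dec ((((vᵢ ⋖? i) ×-dec (vⱼ ≟ j)) ×-dec ((i ⋖? wᵢ) ×-dec (wⱼ ≟ j)))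
  ⊎-dec ((((vᵢ ≟ i) ×-dec (vⱼ ⋖? j)) ×-dec ((wᵢ ≟ i) ×-dec (j ⋖? wⱼ)))
  ⊎-dec ((((vᵢ ≟ i) ×-dec (vⱼ ⋖? j)) ×-dec ((wᵢ ⋖? i) ×-dec (wⱼ ≟ j)))
  ⊎-dec ((((vᵢ ≟ i) ×-dec (vⱼ ⋖? j)) ×-dec ((i ⋖? wᵢ) ×-dec (wⱼ ≟ j)))
  ⊎-dec ((((i ⋖? vᵢ) ×-dec (vⱼ ≟ j)) ×-dec ((wᵢ ≟ i) ×-dec (j ⋖? wⱼ)))
  ⊎-dec (((vᵢ ⋖? i) ×-dec (vⱼ ≟ j)) ×-dec ((wᵢ ≟ i) ×-dec (j ⋖? wⱼ)))))))))
  where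
  _⋖?_ : {k : ℕ} (a b : Fin k) → Dec (a ⋖ b)
  a ⋖? b = toℕ b ℕ.≟ suc (toℕ a)

anyCell? : {n m : ℕ} {P : Cell n m → Set} → Decidable P → Dec (∃ P)
anyCell? P? = map′ (λ (i , j , p) → (i , j) , p) (λ ((i , j) , p) → i , j , p)
                   (any? λ i → any? λ j → P? (i , j))

module _ {n m : ℕ} (S : CellSet n m) where

  private
    _∈ᶜ?_ : (u : Cell n m) (T : CellSet n m) → Dec (u ∈ᶜ T)
    (i , j) ∈ᶜ? T = combine i j ∈? T

    Sound : CellSet n m → Set
    Sound T = (u : Cell n m) → u ∈ᶜ T → C S u

    Extends : CellSet n m → Set
    Extends T = (u : Cell n m) → u ∈ᶜ S → u ∈ᶜ T

    Spreads : CellSet n m → Set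
    Spreads T = ∃ λ (u : Cell n m) → ¬ (u ∈ᶜ T) ×
                ∃ λ (v : Cell n m) → v ∈ᶜ T ×
                ∃ λ (w : Cell n m) → w ∈ᶜ T × Contaminates v w u

    spreads? : (T : CellSet n m) → Dec (Spreads T)
    spreads? T = anyCell? λ u → ¬? (u ∈ᶜ? T) ×-dec
                 anyCell? λ v → (v ∈ᶜ? T) ×-dec
                 anyCell? λ w → (w ∈ᶜ? T) ×-dec contaminates? v w u

    complete : (T : CellSet n m) → Extends T → ¬ Spreads T → (u : Cell n m) → C S u → u ∈ᶜ T
    complete T S⊆T stable u (initial u∈S) = S⊆T u u∈S
    complete T S⊆T stable u (spread {v = v} {w = w} v∈C w∈C r) with u ∈ᶜ? T
    ... | yes u∈T = u∈T
    ... | no  u∉T = contradiction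
      (u , u∉T , v , complete T S⊆T stable v v∈C , w , complete T S⊆T stable w w∈C , r) stable

    combine-injective : {u v : Cell n m} →
      combine (proj₁ u) (proj₂ u) ≡ combine (proj₁ v) (proj₂ v) → u ≡ v
    combine-injective {i , j} {k , l} eq =
      trans (sym (remQuot-combine i j)) (trans (cong (remQuot m) eq) (remQuot-combine k l))

    -- Adds cells to T one at a time until no rule applies; the fuel bounds the
    -- number of cells still missing.
    saturate : (fuel : ℕ) (T : CellSet n m) → n * m ℕ.< ∣ T ∣ + fuel → Extends T → Sound T →
               ∃ λ (T′ : CellSet n m) → Sound T′ × ((u : Cell n m) → C S u → u ∈ᶜ T′)
    saturate zero T bound _ _ =
      contradiction (∣p∣≤n T) (ℕ.<⇒≱ (subst (n * m ℕ.<_) (ℕ.+-identityʳ ∣ T ∣) bound))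
    saturate (suc fuel) T bound S⊆T sound with spreads? T
    ... | no  stable = T , sound , complete T S⊆T stable
    ... | yes (u@(i , j) , u∉T , v , v∈T , w , w∈T , r) = saturate fuel T⁺ bound⁺ S⊆T⁺ sound⁺
      where
      x : Fin (n * m)
      x = combine i j
      T⁺ : CellSet n m
      T⁺ = T ∪ ⁅ x ⁆
      bound⁺ : n * m ℕ.< ∣ T⁺ ∣ + fuel
      bound⁺ = ℕ.<-≤-trans (subst (n * m ℕ.<_) (ℕ.+-suc ∣ T ∣ fuel) bound)
        (ℕ.+-monoˡ-≤ fuel (p⊂q⇒∣p∣<∣q∣ (p⊆p∪q ⁅ x ⁆ , x , q⊆p∪q T ⁅ x ⁆ (x∈⁅x⁆ x) , u∉T)))
      S⊆T⁺ : Extends T⁺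
      S⊆T⁺ y = p⊆p∪q ⁅ x ⁆ ∘ S⊆T y
      sound⁺ : Sound T⁺
      sound⁺ y y∈T⁺ with x∈p∪q⁻ T ⁅ x ⁆ y∈T⁺
      ... | inj₁ y∈T = sound y y∈T
      ... | inj₂ y∈x = subst (C S) (combine-injective {u} {y} (sym (x∈⁅y⁆⇒x≡y x y∈x)))
                             (spread (sound v v∈T) (sound w w∈T) r)

  contaminated? : Decidable (C S)
  contaminated? u =
    let T , sound , comp = saturate (suc (n * m)) S (ℕ.m≤n+m (suc (n * m)) ∣ S ∣)
                                    (λ _ u∈S → u∈S) (λ _ → initial)
    in map′ (sound u) (comp u) (u ∈ᶜ? T)

  contaminating? : Dec (Contaminating S)
  contaminating? = map′ (λ f (i , j) → f i j) (λ f i j → f (i , j))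
    (all? λ i → all? λ j → contaminated? (i , j))

hasContaminatingSetOfSize? : (n m : ℕ) → Decidable (HasContaminatingSetOfSize n m)
hasContaminatingSetOfSize? n m k = anySubset? λ S → (∣ S ∣ ℕ.≟ k) ×-dec contaminating? {n} {m} S

minimum : {P : ℕ → Set} → Decidable P → (k : ℕ) → P k → ∃ (IsMinimum P)
minimum P? zero p = zero , p , λ _ _ → z≤n
minimum {P} P? (suc k) p with P? zero
... | yes p₀ = zero , p₀ , λ _ _ → z≤n
... | no ¬p₀ = let l , q , least = minimum (P? ∘ suc) k p in suc l , q , λ
  { zero    p₀ → contradiction p₀ ¬p₀
  ; (suc i) pᵢ → s≤s (least i pᵢ) }

contaminationMinimum : (n m : ℕ) → ∃ (IsMinimum (HasContaminatingSetOfSize n m))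
contaminationMinimum n m =
  minimum (hasContaminatingSetOfSize? n m) (n * m) (⊤ , ∣⊤∣≡n (n * m) , λ _ → initial ∈⊤)

-- The power contamination number γ_c(G(n,m)).
γc : ℕ → ℕ → ℕ
γc n m = proj₁ (contaminationMinimum n m)

γc-isMinimum : (n m : ℕ) → IsMinimum (HasContaminatingSetOfSize n m) (γc n m)
γc-isMinimum n m = proj₂ (contaminationMinimum n m)

{-# OPTIONS --safe #-}

-- For 3 ≤ n ≤ m one has γc n m = 1 + ⌊m/2⌋, and the corollary is arithmetic.
-- Lower bound: every rule that contaminates a cell of column j uses a cell
-- whose column j′ satisfies ⌈j′/2⌉ = ⌈j/2⌉, so S meets each of the 1 + ⌊m/2⌋
-- column classes {0}, {1,2}, {3,4}, ….
-- Upper bound: for 0 ≤ b ≤ ⌊m/2⌋ take the cell with row min(2b, n-1) and column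
-- min(2b, m-1); by induction on b the rectangle whose corners are (0,0) and the
-- b-th cell becomes contaminated.
module Submission where

open import Defs
open import Data.Nat using (ℕ)
open import Data.Integer using (ℤ; +_; _+_; _-_; _≤_; _≥_; ∣_∣)
open import Data.Integer.Divisibility using (_∣_)
open import Data.Rational.Unnormalised using (_/_; floor; ceiling)
open import Data.Product using (_×_)
open import Relation.Nullary using (¬_)
open import Relation.Binary.PropositionalEquality using (_≡_)

open import Data.Fin using (Fin; zero; suc; toℕ; fromℕ<; combine; remQuot)
open import Data.Fin.Properties using (toℕ-fromℕ<; fromℕ<-toℕ; toℕ≤pred[n]; remQuot-combine)
open import Data.Fin.Subset as Subset using (Subset; _∈_; _∪_; ⁅_⁆; ⊥; inside; outside)
open import Data.Fin.Subset.Properties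
  using (∪-identityˡ; ∣⊥∣≡0; p⊆p∪q; q⊆p∪q; x∈⁅x⁆; x∈p∧x≢y⇒x∈p-y; x∈p⇒∣p-x∣<∣p∣)
open import Data.Integer using (+<+; -_; drop‿+≤+)
import Data.Integer as ℤ
import Data.Integer.DivMod as ℤ
import Data.Integer.Divisibility.Signed as Signed
import Data.Integer.Properties as ℤ
import Data.Integer.Tactic.RingSolver as ℤ
open import Data.Nat using (zero; suc; z≤n; s≤s; _⊓_; ⌊_/2⌋; ⌈_/2⌉)
import Data.Nat as ℕ
import Data.Nat.Divisibility as ℕ
import Data.Nat.Properties as ℕ
open import Data.Product using (∃; Σ; _,_; proj₁; proj₂)
open import Data.Sum using (_⊎_; inj₁; inj₂)
import Data.Sum as Sum
open import Data.Vec using (_∷_)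
open import Relation.Binary.PropositionalEquality using (refl; sym; trans; cong; cong₂; subst; module ≡-Reasoning)
open import Relation.Nullary using (contradiction)

-- Cardinalities of finite subsets.

∣⁅x⁆∪p∣≤1+∣p∣ : ∀ {k} (x : Fin k) (p : Subset k) → Subset.∣ ⁅ x ⁆ ∪ p ∣ ℕ.≤ suc Subset.∣ p ∣
∣⁅x⁆∪p∣≤1+∣p∣ zero    (outside ∷ p) rewrite ∪-identityˡ p = ℕ.≤-refl
∣⁅x⁆∪p∣≤1+∣p∣ zero    (inside  ∷ p) rewrite ∪-identityˡ p = ℕ.n≤1+n _
∣⁅x⁆∪p∣≤1+∣p∣ (suc x) (outside ∷ p) = ∣⁅x⁆∪p∣≤1+∣p∣ x p
∣⁅x⁆∪p∣≤1+∣p∣ (suc x) (inside  ∷ p) = s≤s (∣⁅x⁆∪p∣≤1+∣p∣ x p)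

-- `f` may repeat values, so `l` bounds the cardinality from above only.
image< : ∀ {k} → ℕ → (ℕ → Fin k) → Subset k
image< zero    f = ⊥
image< (suc l) f = ⁅ f l ⁆ ∪ image< l f

∣image<∣≤ : ∀ {k} l (f : ℕ → Fin k) → Subset.∣ image< l f ∣ ℕ.≤ l
∣image<∣≤ {k} zero f = ℕ.≤-reflexive (∣⊥∣≡0 k)
∣image<∣≤ (suc l)  f = ℕ.≤-trans (∣⁅x⁆∪p∣≤1+∣p∣ (f l) (image< l f)) (s≤s (∣image<∣≤ l f))

∈-image< : ∀ {k} l (f : ℕ → Fin k) {b} → b ℕ.< l → f b ∈ image< l f
∈-image< (suc l) f (s≤s b≤l) with ℕ.m≤n⇒m<n∨m≡n b≤l
... | inj₁ b<l  = q⊆p∪q ⁅ f l ⁆ (image< l f) (∈-image< l f b<l)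
... | inj₂ refl = p⊆p∪q (image< l f) (x∈⁅x⁆ (f l))

-- Induction on `l`: delete one element of the top class. The witnesses for smaller classes differ
-- from it in class, so they survive.
classes-≤-∣p∣ : ∀ {k} (class : Fin k → ℕ) l (p : Subset k) →
  (∀ b → b ℕ.< l → ∃ λ x → x ∈ p × class x ≡ b) → l ℕ.≤ Subset.∣ p ∣
classes-≤-∣p∣ class zero    p meets = z≤n
classes-≤-∣p∣ class (suc l) p meets with meets l ℕ.≤-refl
... | x , x∈p , class-x≡l = ℕ.≤-<-trans (classes-≤-∣p∣ class l (p Subset.- x) meets-rest) (x∈p⇒∣p-x∣<∣p∣ x∈p)
  where
  meets-rest : ∀ b → b ℕ.< l → ∃ λ y → y ∈ p Subset.- x × class y ≡ b
  meets-rest b b<l with meets b (ℕ.m≤n⇒m≤1+n b<l)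
  ... | y , y∈p , class-y≡b = y , x∈p∧x≢y⇒x∈p-y y∈p y≢x , class-y≡b
    where
    y≢x : ¬ (y ≡ x)
    y≢x refl = ℕ.<⇒≢ b<l (trans (sym class-y≡b) class-x≡l)

-- Halves of natural numbers.

-- Halving pairs 2t with 2t+1, and the partner of `suc k` is one of its two neighbours.
⌊1+k/2⌋≡⌊k/2⌋∨⌊2+k/2⌋ : ∀ k → ⌊ k /2⌋ ≡ ⌊ suc k /2⌋ ⊎ ⌊ suc (suc k) /2⌋ ≡ ⌊ suc k /2⌋
⌊1+k/2⌋≡⌊k/2⌋∨⌊2+k/2⌋ zero          = inj₁ refl
⌊1+k/2⌋≡⌊k/2⌋∨⌊2+k/2⌋ (suc zero)    = inj₂ refl
⌊1+k/2⌋≡⌊k/2⌋∨⌊2+k/2⌋ (suc (suc k)) = Sum.map (cong suc) (cong suc) (⌊1+k/2⌋≡⌊k/2⌋∨⌊2+k/2⌋ k)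

⌈/2⌉-surjective : ∀ k b → b ℕ.≤ ⌈ k /2⌉ → ∃ λ j → j ℕ.≤ k × ⌈ j /2⌉ ≡ b
⌈/2⌉-surjective k             zero    _         = zero , z≤n , refl
⌈/2⌉-surjective (suc zero)    (suc b) (s≤s b≤0) = 1 , ℕ.≤-refl , cong suc (sym (ℕ.n≤0⇒n≡0 b≤0))
⌈/2⌉-surjective (suc (suc k)) (suc b) (s≤s b≤)  =
  let j , j≤k , eq = ⌈/2⌉-surjective k b b≤ in suc (suc j) , s≤s (s≤s j≤k) , cong suc eq

n≤⌈n/2⌉*2 : ∀ n → n ℕ.≤ ⌈ n /2⌉ ℕ.* 2
n≤⌈n/2⌉*2 zero          = z≤n
n≤⌈n/2⌉*2 (suc zero)    = s≤s z≤n
n≤⌈n/2⌉*2 (suc (suc n)) = s≤s (s≤s (n≤⌈n/2⌉*2 n))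

-- Lower bound by column classes.

-- Rounding up isolates column 0; rounding down would give one class fewer when `m` is even.
columnClass : ∀ {n m} → Cell n m → ℕ
columnClass (_ , j) = ⌈ toℕ j /2⌉

-- Either a source lies in the column of `u`, or the sources lie in the two adjacent columns, one of
-- which shares the class of `u`.
contaminates-columnClass : ∀ {n m} {v w u : Cell n m} → Contaminates v w u →
  columnClass v ≡ columnClass u ⊎ columnClass w ≡ columnClass u
contaminates-columnClass {n} {m} = λ
  { (inj₁ ((_ , p) , _ , q)) → between p q
  ; (inj₂ (inj₁ ((_ , p) , _ , q))) → between p q
  ; (inj₂ (inj₂ (inj₁ ((_ , p) , _)))) → inj₁ (same p)
  ; (inj₂ (inj₂ (inj₂ (inj₁ ((_ , p) , _ , q))))) → between p q
  ; (inj₂ (inj₂ (inj₂ (inj₂ (inj₁ (_ , _ , q)))))) → inj₂ (same q)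
  ; (inj₂ (inj₂ (inj₂ (inj₂ (inj₂ (inj₁ (_ , _ , q))))))) → inj₂ (same q)
  ; (inj₂ (inj₂ (inj₂ (inj₂ (inj₂ (inj₂ (inj₁ ((_ , p) , _)))))))) → inj₁ (same p)
  ; (inj₂ (inj₂ (inj₂ (inj₂ (inj₂ (inj₂ (inj₂ ((_ , p) , _)))))))) → inj₁ (same p)
  }
  where
  same : {j j′ : Fin m} → j ≡ j′ → ⌈ toℕ j /2⌉ ≡ ⌈ toℕ j′ /2⌉
  same = cong (λ j → ⌈ toℕ j /2⌉)
  between : {j j′ j″ : Fin m} → j ⋖ j′ → j′ ⋖ j″ →
    ⌈ toℕ j /2⌉ ≡ ⌈ toℕ j′ /2⌉ ⊎ ⌈ toℕ j″ /2⌉ ≡ ⌈ toℕ j′ /2⌉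
  -- `⌈ x /2⌉` unfolds to `⌊ suc x /2⌋`, hence the shift by one.
  between {j} p q rewrite q | p = ⌊1+k/2⌋≡⌊k/2⌋∨⌊2+k/2⌋ (suc (toℕ j))

-- Passing repeatedly to a source of the same class ends at an initial cell.
C-columnClass : ∀ {n m} {S : CellSet n m} {u : Cell n m} → C S u →
  ∃ λ (x : Cell n m) → x ∈ᶜ S × columnClass x ≡ columnClass u
C-columnClass {u = u} (initial u∈S) = u , u∈S , refl
C-columnClass {n} {m} {S} (spread cv cw r) with contaminates-columnClass r
... | inj₁ eq = let x , x∈S , eq′ = C-columnClass {n} {m} {S} cv in x , x∈S , trans eq′ eq
... | inj₂ eq = let x , x∈S , eq′ = C-columnClass {n} {m} {S} cw in x , x∈S , trans eq′ eq

contaminating-lower : ∀ {n m} (S : CellSet (suc n) m) → Contaminating {suc n} {m} S → 0 ℕ.< m →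
  suc ⌊ m /2⌋ ℕ.≤ Subset.∣ S ∣
contaminating-lower {n} {m@(suc M)} S full _ = classes-≤-∣p∣ class (suc ⌊ m /2⌋) S meets
  where
  cell : Fin (suc n ℕ.* m) → Cell (suc n) m
  cell = remQuot m
  class : Fin (suc n ℕ.* m) → ℕ
  class x = columnClass (cell x)
  meets : ∀ b → b ℕ.< suc ⌊ m /2⌋ → ∃ λ x → x ∈ S × class x ≡ b
  meets b (s≤s b≤) =
    -- `b≤` fits because `⌈ M /2⌉` unfolds to `⌊ suc M /2⌋`; the cell is taken in row 0.
    let j , j≤M , ⌈j⌉≡b = ⌈/2⌉-surjective M b b≤
        (k , l) , x∈S , eq = C-columnClass {suc n} {m} {S} (full (zero , fromℕ< (s≤s j≤M)))
    in combine k l , x∈S ,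
       trans (cong columnClass (remQuot-combine {suc n} k l))
         (trans eq (trans (cong ⌈_/2⌉ (toℕ-fromℕ< (s≤s j≤M))) ⌈j⌉≡b))

-- Upper bound by growing rectangles.

-- How far one clipped coordinate moves between consecutive diagonal cells: by 2 until clipping sets
-- in, then by 1 or 0.
data Step : ℕ → ℕ → Set where
  +0 : ∀ {r} → Step r r
  +1 : ∀ {r} → Step r (suc r)
  +2 : ∀ {r} → Step r (suc (suc r))

step-suc : ∀ {r s} → Step r s → Step (suc r) (suc s)
step-suc +0 = +0
step-suc +1 = +1
step-suc +2 = +2

step-⊓ : ∀ t k → Step (t ⊓ k) (suc (suc t) ⊓ k)
step-⊓ zero    zero          = +0
step-⊓ zero    (suc zero)    = +1
step-⊓ zero    (suc (suc k)) = +2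
step-⊓ (suc t) zero          = +0
step-⊓ (suc t) (suc k)       = step-suc (step-⊓ t k)

fromℕ<-⋖ : ∀ {i n} .(i<n : i ℕ.< n) .(1+i<n : suc i ℕ.< n) → fromℕ< i<n ⋖ fromℕ< 1+i<n
fromℕ<-⋖ i<n 1+i<n = trans (toℕ-fromℕ< 1+i<n) (cong suc (sym (toℕ-fromℕ< i<n)))

module Filling {n m : ℕ} (S : CellSet n m) where

  -- Natural coordinates let neighbours be written with `suc`. `fromℕ<` ignores its bound proof, so
  -- cells with equal coordinates agree definitionally.
  Covered : ℕ → ℕ → Set
  Covered i j = Σ (i ℕ.< n) λ i<n → Σ (j ℕ.< m) λ j<m → C S (fromℕ< i<n , fromℕ< j<m)

  NW-SE : ∀ {i j} → Covered i j → Covered (suc (suc i)) (suc (suc j)) → Covered (suc i) (suc j)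
  NW-SE (p , q , c) (p″ , q″ , c″) = p′ , q′ ,
    spread c c″ (inj₁ ((fromℕ<-⋖ p p′ , fromℕ<-⋖ q q′) , fromℕ<-⋖ p′ p″ , fromℕ<-⋖ q′ q″))
    where
    p′ = ℕ.<-trans ℕ.≤-refl p″
    q′ = ℕ.<-trans ℕ.≤-refl q″

  N-S : ∀ {i j} → Covered i j → Covered (suc (suc i)) j → Covered (suc i) j
  N-S (p , q , c) (p″ , _ , c″) = p′ , q ,
    spread c c″ (inj₂ (inj₂ (inj₁ ((fromℕ<-⋖ p p′ , refl) , fromℕ<-⋖ p′ p″ , refl))))
    where p′ = ℕ.<-trans ℕ.≤-refl p″

  W-E : ∀ {i j} → Covered i j → Covered i (suc (suc j)) → Covered i (suc j)
  W-E (p , q , c) (_ , q″ , c″) = p , q′ ,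
    spread c c″ (inj₂ (inj₂ (inj₂ (inj₁ ((refl , fromℕ<-⋖ q q′) , refl , fromℕ<-⋖ q′ q″)))))
    where q′ = ℕ.<-trans ℕ.≤-refl q″

  W-N : ∀ {i j} → Covered (suc i) j → Covered i (suc j) → Covered (suc i) (suc j)
  W-N (p′ , q , c) (p , q′ , c′) = p′ , q′ ,
    spread c c′ (inj₂ (inj₂ (inj₂ (inj₂ (inj₁ ((refl , fromℕ<-⋖ q q′) , fromℕ<-⋖ p p′ , refl))))))

  W-S : ∀ {i j} → Covered i j → Covered (suc i) (suc j) → Covered i (suc j)
  W-S (p , q , c) (p′ , q′ , c′) = p , q′ ,
    spread c c′ (inj₂ (inj₂ (inj₂ (inj₂ (inj₂ (inj₁ ((refl , fromℕ<-⋖ q q′) , fromℕ<-⋖ p p′ , refl)))))))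

  N-E : ∀ {i j} → Covered i j → Covered (suc i) (suc j) → Covered (suc i) j
  N-E (p , q , c) (p′ , q′ , c′) = p′ , q ,
    spread c c′ (inj₂ (inj₂ (inj₂ (inj₂ (inj₂ (inj₂ (inj₂ ((fromℕ<-⋖ p p′ , refl) , refl , fromℕ<-⋖ q q′))))))))

  Rectangle : ℕ → ℕ → Set
  Rectangle r c = ∀ {i j} → i ℕ.≤ r → j ℕ.≤ c → Covered i j

  corner : ∀ {r c} → Rectangle r c → Covered r c
  corner R = R ℕ.≤-refl ℕ.≤-refl

  -- One cell beside the rectangle suffices: it spreads north by `W-S` and south by `W-N`, the
  -- western source always lying in the rectangle.
  addColumn : ∀ {r c i} → Rectangle r c → i ℕ.≤ r → Covered i (suc c) → Rectangle r (suc c)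
  addColumn {r} {c} {i} R i≤r x {k} {j} k≤r j≤1+c with ℕ.m≤n⇒m<n∨m≡n j≤1+c
  ... | inj₁ (s≤s j≤c) = R k≤r j≤c
  ... | inj₂ refl with ℕ.≤-total k i
  ...   | inj₁ k≤i = north (ℕ.≤⇒≤′ k≤i) i≤r x
    where
    north : ∀ {i} → k ℕ.≤′ i → i ℕ.≤ r → Covered i (suc c) → Covered k (suc c)
    north ℕ.≤′-refl        _    y = y
    north (ℕ.≤′-step k≤′i) i<r y = north k≤′i (ℕ.<⇒≤ i<r) (W-S (R (ℕ.<⇒≤ i<r) ℕ.≤-refl) y)
  ...   | inj₂ i≤k = south (ℕ.≤⇒≤′ i≤k) k≤r
    where
    south : ∀ {k} → i ℕ.≤′ k → k ℕ.≤ r → Covered k (suc c)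
    south ℕ.≤′-refl        _   = x
    south (ℕ.≤′-step i≤′k) k<r = W-N (R k<r ℕ.≤-refl) (south i≤′k (ℕ.<⇒≤ k<r))

  -- The transpose of `addColumn`: west by `N-E`, east by `W-N`.
  addRow : ∀ {r c j} → Rectangle r c → j ℕ.≤ c → Covered (suc r) j → Rectangle (suc r) c
  addRow {r} {c} {j} R j≤c x {i} {k} i≤1+r k≤c with ℕ.m≤n⇒m<n∨m≡n i≤1+r
  ... | inj₁ (s≤s i≤r) = R i≤r k≤c
  ... | inj₂ refl with ℕ.≤-total k j
  ...   | inj₁ k≤j = west (ℕ.≤⇒≤′ k≤j) j≤c x
    where
    west : ∀ {j} → k ℕ.≤′ j → j ℕ.≤ c → Covered (suc r) j → Covered (suc r) k
    west ℕ.≤′-refl        _   y = y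
    west (ℕ.≤′-step k≤′j) j<c y = west k≤′j (ℕ.<⇒≤ j<c) (N-E (R ℕ.≤-refl (ℕ.<⇒≤ j<c)) y)
  ...   | inj₂ j≤k = east (ℕ.≤⇒≤′ j≤k) k≤c
    where
    east : ∀ {k} → j ℕ.≤′ k → k ℕ.≤ c → Covered (suc r) k
    east ℕ.≤′-refl        _   = x
    east (ℕ.≤′-step j≤′k) k<c = W-N (east j≤′k (ℕ.<⇒≤ k<c)) (R ℕ.≤-refl k<c)

  -- The cell east of the old corner is north of the new one, so `W-S` starts the new column; the
  -- new cell itself starts the new row.
  grow₁₁ : ∀ {r c} → Rectangle r c → Covered (suc r) (suc c) → Rectangle (suc r) (suc c)
  grow₁₁ R x = addRow (addColumn R ℕ.≤-refl (W-S (corner R) x)) ℕ.≤-refl x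

  grow₂₂ : ∀ {r c} → Rectangle r c → Covered (suc (suc r)) (suc (suc c)) →
    Rectangle (suc (suc r)) (suc (suc c))
  grow₂₂ R x = grow₁₁ (grow₁₁ R (NW-SE (corner R) x)) x

  -- Each step of length 2 first obtains an intermediate cell from the new cell and one in the
  -- rectangle. Positive sides are for the mixed steps of 1 and 2.
  grow : ∀ {r c r′ c′} → 0 ℕ.< r → 0 ℕ.< c → Step r r′ → Step c c′ →
    Rectangle r c → Covered r′ c′ → Rectangle r′ c′
  grow _ _ +0 +0 R x = R
  grow _ _ +0 +1 R x = addColumn R ℕ.≤-refl x
  grow _ _ +0 +2 R x = addColumn (addColumn R ℕ.≤-refl (W-E (corner R) x)) ℕ.≤-refl x
  grow _ _ +1 +0 R x = addRow R ℕ.≤-refl x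
  grow _ _ +1 +1 R x = grow₁₁ R x
  -- The cell north of the old corner, not the corner, is two diagonal steps from the new cell.
  grow (s≤s {n = r} _) _ +1 +2 R x =
    grow₁₁ (addColumn R ℕ.≤-refl (NW-SE (R (ℕ.n≤1+n r) ℕ.≤-refl) x)) x
  grow _ _ +2 +0 R x = addRow (addRow R ℕ.≤-refl (N-S (corner R) x)) ℕ.≤-refl x
  grow _ (s≤s {n = c} _) +2 +1 R x =
    grow₁₁ (addRow R ℕ.≤-refl (NW-SE (R ℕ.≤-refl (ℕ.n≤1+n c)) x)) x
  grow _ _ +2 +2 R x = grow₂₂ R x

  diagonal-fills : ∀ N M l → 2 ℕ.≤ N → 2 ℕ.≤ M →
    (∀ b → b ℕ.≤ l → Covered (b ℕ.* 2 ⊓ N) (b ℕ.* 2 ⊓ M)) →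
    ∀ b → b ℕ.≤ l → Rectangle (b ℕ.* 2 ⊓ N) (b ℕ.* 2 ⊓ M)
  diagonal-fills N M l _ _ seed zero b≤l z≤n z≤n = seed zero b≤l
  -- The first step starts from a single cell, whose sides are not positive; the bounds on `N` and
  -- `M` make it an unclipped diagonal step of 2.
  diagonal-fills N M l 2≤N@(s≤s (s≤s _)) 2≤M@(s≤s (s≤s _)) seed (suc zero) b≤l =
    grow₂₂ (diagonal-fills N M l 2≤N 2≤M seed zero z≤n) (seed 1 b≤l)
  diagonal-fills N M l 2≤N 2≤M seed (suc b@(suc _)) b<l =
    grow (positive N 2≤N) (positive M 2≤M) (step-⊓ (b ℕ.* 2) N) (step-⊓ (b ℕ.* 2) M)
      (diagonal-fills N M l 2≤N 2≤M seed b (ℕ.<⇒≤ b<l)) (seed (suc b) b<l)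
    where
    positive : ∀ k → 2 ℕ.≤ k → 0 ℕ.< b ℕ.* 2 ⊓ k
    positive (suc k) _ = s≤s z≤n

-- The diagonal contaminating set and the value of `γc`.

contaminating-upper : ∀ N M → 2 ℕ.≤ N → N ℕ.≤ M →
  ∃ λ S → Subset.∣ S ∣ ℕ.≤ suc ⌊ suc M /2⌋ × Contaminating {suc N} {suc M} S
contaminating-upper N M 2≤N N≤M = S , ∣image<∣≤ (suc l) diagonal , full
  where
  l : ℕ
  l = ⌊ suc M /2⌋
  clip : ∀ t k → t ⊓ k ℕ.< suc k
  clip t k = s≤s (ℕ.m⊓n≤n t k)
  diagonal : ℕ → Fin (suc N ℕ.* suc M)
  diagonal b = combine (fromℕ< (clip (b ℕ.* 2) N)) (fromℕ< (clip (b ℕ.* 2) M))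
  S : CellSet (suc N) (suc M)
  S = image< (suc l) diagonal
  open Filling {suc N} {suc M} S
  seed : ∀ b → b ℕ.≤ l → Covered (b ℕ.* 2 ⊓ N) (b ℕ.* 2 ⊓ M)
  seed b b≤l = clip (b ℕ.* 2) N , clip (b ℕ.* 2) M , initial (∈-image< (suc l) diagonal (s≤s b≤l))
  -- With `N≤M` this places the last seed at the corner (`N`, `M`).
  M≤l*2 : M ℕ.≤ l ℕ.* 2
  M≤l*2 = n≤⌈n/2⌉*2 M
  everything : Rectangle N M
  everything i≤N j≤M = diagonal-fills N M l 2≤N (ℕ.≤-trans 2≤N N≤M) seed l ℕ.≤-refl
    (ℕ.⊓-glb (ℕ.≤-trans i≤N (ℕ.≤-trans N≤M M≤l*2)) i≤N) (ℕ.⊓-glb (ℕ.≤-trans j≤M M≤l*2) j≤M)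
  full : Contaminating {suc N} {suc M} S
  full (i , j) =
    let i<n , j<m , c = everything (toℕ≤pred[n] i) (toℕ≤pred[n] j)
    in subst (C S) (cong₂ _,_ (fromℕ<-toℕ i i<n) (fromℕ<-toℕ j j<m)) c

γc≡1+⌊m/2⌋ : ∀ n m → 3 ℕ.≤ n → n ℕ.≤ m → γc n m ≡ suc ⌊ m /2⌋
γc≡1+⌊m/2⌋ n@(suc N) m@(suc M) (s≤s 2≤N) (s≤s N≤M) =
  let (S₀ , ∣S₀∣≡ , full₀) , least = γc-isMinimum n m
      S , ∣S∣≤ , full = contaminating-upper N M 2≤N N≤M
  in ℕ.≤-antisym (ℕ.≤-trans (least Subset.∣ S ∣ (S , refl , full)) ∣S∣≤)
       (subst (suc ⌊ m /2⌋ ℕ.≤_) ∣S₀∣≡ (contaminating-lower S₀ full₀ (s≤s z≤n)))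

-- Parity and halves of integers.

parity : ∀ n → n ≡ ⌊ n /2⌋ ℕ.* 2 ⊎ n ≡ suc (⌊ n /2⌋ ℕ.* 2)
parity zero          = inj₁ refl
parity (suc zero)    = inj₂ refl
parity (suc (suc n)) = Sum.map (cong (λ k → suc (suc k))) (cong (λ k → suc (suc k))) (parity n)

parityℤ : ∀ n → + n ≡ + ⌊ n /2⌋ ℤ.* + 2 ⊎ + n ≡ + 1 + + ⌊ n /2⌋ ℤ.* + 2
parityℤ n = Sum.map
  (λ even → trans (cong +_ even) (ℤ.pos-* ⌊ n /2⌋ 2))
  (λ odd  → trans (cong +_ odd) (cong (λ k → + 1 + k) (ℤ.pos-* ⌊ n /2⌋ 2)))
  (parity n)

even⇒2∣ : ∀ {i} k → i ≡ k ℤ.* + 2 → + 2 ∣ i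
even⇒2∣ k eq = Signed.∣⇒∣ᵤ (Signed.divides k eq)

odd⇒2∤ : ∀ {i} k → i ≡ + 1 + k ℤ.* + 2 → ¬ (+ 2 ∣ i)
odd⇒2∤ k refl 2∣i with Signed.∣⇒∣ᵤ (Signed.∣m+n∣n⇒∣m {+ 2} {+ 1} {k ℤ.* + 2} (Signed.∣ᵤ⇒∣ 2∣i) (Signed.divides k refl))
... | 2∣1 = contradiction (ℕ.∣⇒≤ 2∣1) (ℕ.<⇒≱ (s≤s (s≤s z≤n)))

-- Both quotients bracket `i` between consecutive multiples of `d`; crossing the two brackets gives
-- each inequality.
/ℕ-unique : ∀ i d .{{_ : ℕ.NonZero d}} k e → e ℕ.< d → i ≡ + e + k ℤ.* + d → i ℤ./ℕ d ≡ k
/ℕ-unique i d@(suc _) k e e<d eq = ℤ.≤-antisym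
  (below (i ℤ./ℕ d) k (ℤ.≤-<-trans (ℤ.[n/ℕd]*d≤n i d) i<[1+k]d))
  (below k (i ℤ./ℕ d) (ℤ.≤-<-trans kd≤i (ℤ.n<s[n/ℕd]*d i d)))
  where
  below : ∀ a b → a ℤ.* + d ℤ.< ℤ.suc b ℤ.* + d → a ≤ b
  below a b lt = subst (a ≤_) (ℤ.pred-suc b) (ℤ.i<j⇒i≤pred[j] (ℤ.*-cancelʳ-<-nonNeg {a} {ℤ.suc b} (+ d) lt))
  kd≤i : k ℤ.* + d ≤ i
  kd≤i = subst (k ℤ.* + d ≤_) (sym eq) (ℤ.i≤j+i (k ℤ.* + d) (+ e))
  i<[1+k]d : i ℤ.< ℤ.suc k ℤ.* + d
  i<[1+k]d = subst (ℤ._< ℤ.suc k ℤ.* + d) (sym eq)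
    (subst (λ j → + e + k ℤ.* + d ℤ.< j) (sym (ℤ.suc-* k (+ d))) (ℤ.+-monoˡ-< (k ℤ.* + d) (+<+ e<d)))

floor-half : ∀ {q} k e → e ℕ.< 2 → q ≡ + e + k ℤ.* + 2 → ⌊ q / 2 ⌋ ≡ k
floor-half {q} k e e<2 eq = trans (ℤ.div-pos-is-/ℕ q 2) (/ℕ-unique q 2 k e e<2 eq)

-- The ceiling is minus the floor of the negation, and negating 2k-1 gives 2(-k)+1, of remainder 1.
ceiling-half : ∀ {q} k → q ≡ k ℤ.* + 2 - + 1 → ⌈ q / 2 ⌉ ≡ k
ceiling-half {q} k eq =
  trans (cong -_ (floor-half (- k) 1 (s≤s (s≤s z≤n)) (trans (cong -_ eq) (flip k)))) (ℤ.neg-involutive k)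
  where
  flip : ∀ k → - (k ℤ.* + 2 - + 1) ≡ + 1 + - k ℤ.* + 2
  flip = ℤ.solve-∀

-- The difference of halves is q/2 for equal parities, (q-1)/2 if only `m` is odd and (q+1)/2 if
-- only `m′` is odd. The last case is exactly `m` even and `q` odd.
half-difference : ∀ m m′ q → q ≡ + m - + m′ →
  (((+ 2 ∣ + m) × ¬ (+ 2 ∣ q)) → ⌈ q / 2 ⌉ ≡ + ⌊ m /2⌋ - + ⌊ m′ /2⌋)
  ×
  (¬ ((+ 2 ∣ + m) × ¬ (+ 2 ∣ q)) → ⌊ q / 2 ⌋ ≡ + ⌊ m /2⌋ - + ⌊ m′ /2⌋)
half-difference m m′ q q≡m-m′ = case (parityℤ m) (parityℤ m′)
  where
  a = + ⌊ m /2⌋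
  a′ = + ⌊ m′ /2⌋
  half = a - a′

  Claim : Set
  Claim = (((+ 2 ∣ + m) × ¬ (+ 2 ∣ q)) → ⌈ q / 2 ⌉ ≡ half)
        × (¬ ((+ 2 ∣ + m) × ¬ (+ 2 ∣ q)) → ⌊ q / 2 ⌋ ≡ half)

  q≡ : ∀ {x y z} → + m ≡ x → + m′ ≡ y → x - y ≡ z → q ≡ z
  q≡ x≡ y≡ z≡ = trans q≡m-m′ (trans (cong₂ _-_ x≡ y≡) z≡)

  even-even : ∀ x y → x ℤ.* + 2 - y ℤ.* + 2 ≡ (x - y) ℤ.* + 2
  even-even = ℤ.solve-∀
  even-odd : ∀ x y → x ℤ.* + 2 - (+ 1 + y ℤ.* + 2) ≡ (x - y) ℤ.* + 2 - + 1
  even-odd = ℤ.solve-∀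
  -- The same value with remainder 1 instead of -1, as needed to see that `q` is odd.
  even-odd′ : ∀ x y → x ℤ.* + 2 - (+ 1 + y ℤ.* + 2) ≡ + 1 + (x - y - + 1) ℤ.* + 2
  even-odd′ = ℤ.solve-∀
  odd-even : ∀ x y → + 1 + x ℤ.* + 2 - y ℤ.* + 2 ≡ + 1 + (x - y) ℤ.* + 2
  odd-even = ℤ.solve-∀
  odd-odd : ∀ x y → + 1 + x ℤ.* + 2 - (+ 1 + y ℤ.* + 2) ≡ + 0 + (x - y) ℤ.* + 2
  odd-odd = ℤ.solve-∀

  case : + m ≡ a ℤ.* + 2 ⊎ + m ≡ + 1 + a ℤ.* + 2 →
         + m′ ≡ a′ ℤ.* + 2 ⊎ + m′ ≡ + 1 + a′ ℤ.* + 2 → Claim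
  case (inj₁ m≡) (inj₁ m′≡) =
    let eq = q≡ m≡ m′≡ (even-even a a′) in
    (λ (_ , 2∤q) → contradiction (even⇒2∣ half eq) 2∤q) ,
    λ _ → floor-half half 0 (s≤s z≤n) (trans eq (sym (ℤ.+-identityˡ _)))
  case (inj₁ m≡) (inj₂ m′≡) =
    (λ _ → ceiling-half half (q≡ m≡ m′≡ (even-odd a a′))) ,
    λ other → contradiction
      (even⇒2∣ a m≡ , odd⇒2∤ (half - + 1) (q≡ m≡ m′≡ (even-odd′ a a′))) other
  case (inj₂ m≡) (inj₁ m′≡) =
    (λ (2∣m , _) → contradiction 2∣m (odd⇒2∤ a m≡)) ,
    λ _ → floor-half half 1 (s≤s (s≤s z≤n)) (q≡ m≡ m′≡ (odd-even a a′))
  case (inj₂ m≡) (inj₂ m′≡) =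
    (λ (2∣m , _) → contradiction 2∣m (odd⇒2∤ a m≡)) ,
    λ _ → floor-half half 0 (s≤s z≤n) (q≡ m≡ m′≡ (odd-odd a a′))

-- Passage to the reduced grid.

i-[i-j]≡j : ∀ i j → i - (i - j) ≡ j
i-[i-j]≡j = ℤ.solve-∀

i≤j-k⇒k≤j-i : ∀ i j k → i ≤ j - k → k ≤ j - i
i≤j-k⇒k≤j-i i j k i≤j-k =
  subst (_≤ j - i) (i-[i-j]≡j j k) (ℤ.+-monoʳ-≤ j (ℤ.neg-mono-≤ i≤j-k))

γc-difference : ∀ n m n′ m′ → 3 ℕ.≤ n → n ℕ.≤ m → 3 ℕ.≤ n′ → n′ ℕ.≤ m′ → ∀ k →
  k ≡ + ⌊ m /2⌋ - + ⌊ m′ /2⌋ → + γc n m ≡ + γc n′ m′ + k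
γc-difference n m n′ m′ 3≤n n≤m 3≤n′ n′≤m′ k k≡ = begin
  + γc n m                                          ≡⟨ cong +_ (γc≡1+⌊m/2⌋ n m 3≤n n≤m) ⟩
  + 1 + + ⌊ m /2⌋                                   ≡⟨ telescope (+ ⌊ m /2⌋) (+ ⌊ m′ /2⌋) ⟩
  + 1 + + ⌊ m′ /2⌋ + (+ ⌊ m /2⌋ - + ⌊ m′ /2⌋)       ≡⟨ cong₂ (λ g d → + g + d) (γc≡1+⌊m/2⌋ n′ m′ 3≤n′ n′≤m′) k≡ ⟨
  + γc n′ m′ + k                                    ∎
  where
  open ≡-Reasoning
  telescope : ∀ x y → + 1 + x ≡ + 1 + y + (x - y)
  telescope = ℤ.solve-∀

corollary4 : (n m : ℕ) (p q : ℤ) →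
    + m ≥ + n → + n ≥ + 3 →
    p ≤ + n - + 3 → q ≤ + m - + 3 →
    + m - q ≥ + n - p →
    (((+ 2 ∣ + m) × ¬ (+ 2 ∣ q)) →
    + γc n m ≡ + γc ∣ + n - p ∣ ∣ + m - q ∣ + ⌈ q / 2 ⌉)
    ×
    (¬ ((+ 2 ∣ + m) × ¬ (+ 2 ∣ q)) →
    + γc n m ≡ + γc ∣ + n - p ∣ ∣ + m - q ∣ + ⌊ q / 2 ⌋)
corollary4 n m p q m≥n n≥3 p≤n-3 q≤m-3 m-q≥n-p =
  (λ h → γc-difference n m ∣ + n - p ∣ ∣ + m - q ∣ 3≤n n≤m 3≤n′ n′≤m′ ⌈ q / 2 ⌉ (proj₁ halves h)) ,
  (λ h → γc-difference n m ∣ + n - p ∣ ∣ + m - q ∣ 3≤n n≤m 3≤n′ n′≤m′ ⌊ q / 2 ⌋ (proj₂ halves h))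
  where
  n′ = ∣ + n - p ∣
  m′ = ∣ + m - q ∣

  3≤n : 3 ℕ.≤ n
  3≤n = drop‿+≤+ n≥3
  n≤m : n ℕ.≤ m
  n≤m = drop‿+≤+ m≥n
  3≤n-p : + 3 ≤ + n - p
  3≤n-p = i≤j-k⇒k≤j-i p (+ n) (+ 3) p≤n-3
  -- Both differences are at least 3, so the absolute values in the statement leave them unchanged.
  +n′≡ : + n′ ≡ + n - p
  +n′≡ = ℤ.0≤i⇒+∣i∣≡i (ℤ.≤-trans (ℤ.+≤+ z≤n) 3≤n-p)
  +m′≡ : + m′ ≡ + m - q
  +m′≡ = ℤ.0≤i⇒+∣i∣≡i (ℤ.≤-trans (ℤ.+≤+ z≤n) (i≤j-k⇒k≤j-i q (+ m) (+ 3) q≤m-3))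
  3≤n′ : 3 ℕ.≤ n′
  3≤n′ = drop‿+≤+ (subst (+ 3 ≤_) (sym +n′≡) 3≤n-p)
  n′≤m′ : n′ ℕ.≤ m′
  n′≤m′ = drop‿+≤+ (subst (_≤ + m′) (sym +n′≡) (subst (+ n - p ≤_) (sym +m′≡) m-q≥n-p))
  q≡m-m′ : q ≡ + m - + m′
  q≡m-m′ = sym (trans (cong (λ k → + m - k) +m′≡) (i-[i-j]≡j (+ m) q))
  halves = half-difference m m′ q q≡m-m′
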